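{- Let $G=(V,E)$ be a finite graph of girth $g$, let $v\in V$, and let $r\ge 0$ be an integer with $2r+1<g$. Then the subgraph of $G$ induced on the ball $B_r(v)$ is a tree, and consequently every signing of $G$, restricted to $B_r(v)$, is switching-equivalent to the all-positive signing by switchings supported inside the ball; that is, for every $\sigma:E\to\{\pm1\}$ there is a set $S\subseteq B_r(v)$ such that for every edge $e$ of the induced subgraph $G[B_r(v)]$, $\sigma(e)=-1$ if and only if $e$ has exactly one endpoint in $S$.
   Context: $B_r(v)$ is the set of vertices at graph distance at most $r$ from $v$. The girth is the length of a shortest cycle ($+\infty$ if there are no cycles). A signing of a graph is a map $\sigma$ from its edges to $\{\pm1\}$, identified with the $\mathbb{F}_2$-indicator vector of its negative edges. Switching a set $S$ of vertices flips the signs of exactly the edges with exactly one endpoint in $S$; two signings are switching-equivalent if they differ by such a cut $\delta(S)$. -}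

module Defs where

open import Data.Fin.Base using (Fin; _<_)
open import Data.Fin.Subset using (Subset; _∈_; _∉_)
open import Data.List.Base using (List; []; _∷_)
open import Data.List.Relation.Unary.Unique.Propositional using (Unique)
open import Data.Nat.Base using (ℕ; suc; _≤_)
open import Data.Product.Base using (_×_; _,_; ∃; ∃-syntax; proj₁; proj₂)
open import Data.Refinement.Base using (Refinement; Refinement-syntax; value)
open import Data.Sign.Base using (Sign)
open import Data.Sum.Base using (_⊎_)
open import Function.Base using (_on_)
open import Level using (0ℓ)
open import Relation.Binary.Construct.Closure.ReflexiveTransitive using (Star; ε; _◅_)
open import Relation.Binary.Core using (Rel)
open import Relation.Binary.Definitions using (Decidable; Symmetric)
open import Relation.Binary.PropositionalEquality.Core using (_≡_)
open import Relation.Nullary.Construct.Add.Supremum using (_⁺; [_]; ⊤⁺)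
open import Relation.Nullary.Negation.Core using (¬_)
open import Relation.Unary using (Pred)

record Graph (V : Set) : Set₁ where
  infix 4 _~_ _~?_
  field
    _~_     : Rel V 0ℓ
    _~?_    : Decidable _~_
    ~-sym   : Symmetric _~_
    ~-irref : ∀ {u} → ¬ (u ~ u)

module _ {V : Set} (G : Graph V) where
  open Graph G

  Walk : V → V → Set
  Walk = Star _~_

  length : ∀ {u v} → Walk u v → ℕ
  length ε       = 0
  length (_ ◅ w) = suc (length w)

  vertices : ∀ {u v} → Walk u v → List V
  vertices {u} ε       = u ∷ []
  vertices {u} (_ ◅ w) = u ∷ vertices w

  -- A cycle is a path on at least three vertices together with an edge
  -- joining its last vertex to its first.
  record Cycle : Set where
    field
      {first last} : V
      path         : Walk first last
      distinct     : Unique (vertices path)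
      nontrivial   : 2 ≤ length path
      closing      : last ~ first

  cycleLength : Cycle → ℕ
  cycleLength c = suc (length (Cycle.path c))

  IsGirth : ℕ ⁺ → Set
  IsGirth [ g ] = (∃[ c ] cycleLength c ≡ g) × (∀ c → g ≤ cycleLength c)
  IsGirth ⊤⁺    = ¬ Cycle

  record IsTree : Set where
    field
      root      : V
      connected : ∀ u v → Walk u v
      acyclic   : ¬ Cycle

  IsDistance : V → V → ℕ → Set
  IsDistance u v d = (∃[ w ] length {u} {v} w ≡ d) × (∀ (w : Walk u v) → d ≤ length w)

  Ball : ℕ → V → Pred V 0ℓ
  Ball r v u = ∃[ d ] IsDistance v u d × d ≤ r

  -- Membership in P is irrelevant in the vertex type, so that each vertex of G
  -- satisfying P occurs only once, however many proofs of P it has.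
  induced : (P : Pred V 0ℓ) → Graph [ u ∈ V ∣ P u ]
  induced P = record
    { _~_     = _~_ on value
    ; _~?_    = λ u v → value u ~? value v
    ; ~-sym   = ~-sym
    ; ~-irref = ~-irref
    }

module _ {n : ℕ} (G : Graph (Fin n)) where
  open Graph G

  -- An unordered edge is represented by its endpoints in increasing order;
  -- irrelevance of the proofs makes the endpoints determine the edge.
  Edge : Set
  Edge = [ e ∈ Fin n × Fin n ∣ proj₁ e < proj₂ e × proj₁ e ~ proj₂ e ]

  Signing : Set
  Signing = Edge → Sign

  -- The edges of the subgraph induced on P, as a set of edges of G.
  InducedEdge : Pred (Fin n) 0ℓ → Pred Edge 0ℓ
  InducedEdge P e = let (u , v) = value e in P u × P v

  δ : Subset n → Pred Edge 0ℓ
  δ S e = let (u , v) = value e in (u ∈ S × v ∉ S) ⊎ (u ∉ S × v ∈ S)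

{-# OPTIONS --safe #-}
-- If two distinct vertices at distance k from v are the ends of a path whose
-- vertices are all at distance at least k, then prolonging the path at both ends
-- by vertices one step closer to v, until the two ends meet, closes a cycle of
-- length at most 2k plus the length of the path. When 2r + 1 is below the girth,
-- this excludes edges inside a level of the ball and vertices with two neighbours
-- one level closer to v. A graph layered in this way has no cycle, and the
-- products of the signs along shortest walks from v give the switching set.
module Submission where

open import Defs
open import Data.Fin.Base using (Fin)
import Data.Fin.Base as Fin
open import Data.Fin.Properties using (any?)
import Data.Fin.Properties as Fin
open import Data.Fin.Subset using (Subset; _∈_)
open import Data.Irrelevant using () renaming ([_] to irr)
open import Data.List.Base using ([]; _∷_; _++_)
import Data.List.Membership.Propositional as List
open import Data.List.Relation.Unary.All as All using (All; []; _∷_)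
import Data.List.Relation.Unary.All.Properties as All
open import Data.List.Relation.Unary.AllPairs using ([]; _∷_)
open import Data.List.Relation.Unary.Any using (here; there)
open import Data.List.Relation.Unary.Unique.Propositional using (Unique)
import Data.List.Relation.Unary.Unique.Propositional.Properties as Unique
open import Data.Nat.Base using (ℕ; zero; suc; _+_; _*_; _<_; _≤_; z≤n; s≤s; s≤s⁻¹)
import Data.Nat.Properties as ℕ
open import Data.Nat.Tactic.RingSolver using (solve-∀)
open import Data.Product.Base using (_×_; Σ-syntax; ∃-syntax; _,_; proj₁; proj₂)
open import Data.Refinement.Base using (Refinement-syntax; value; _,_)
open import Data.Refinement.Properties using (value-injective)
open import Data.Sign.Base using (Sign)
import Data.Sign.Base as Sign
import Data.Sign.Properties as Sign
open import Data.Sum.Base using (_⊎_; inj₁; inj₂)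
open import Data.Vec.Base using (tabulate)
open import Data.Vec.Properties using (lookup∘tabulate; lookup⇒[]=; []=⇒lookup)
open import Function.Base using (_∘_)
open import Function.Bundles using (_⇔_; mk⇔; Equivalence)
open import Level using (0ℓ)
open import Relation.Binary.Construct.Add.Supremum.Strict _<_ using (_<⁺_; [_]; [_]<⊤⁺)
open import Relation.Binary.Construct.Closure.ReflexiveTransitive using (ε; _◅_; _◅◅_; reverse)
open import Relation.Binary.Definitions using (tri<; tri≈; tri>)
open import Relation.Binary.PropositionalEquality.Core
  using (_≡_; _≢_; refl; sym; trans; cong; subst)
open import Relation.Nullary.Construct.Add.Supremum using (_⁺; [_])
open import Relation.Nullary.Decidable.Core
  using (Dec; yes; no; does; map′; recompute; _×-dec_)
open import Relation.Nullary.Decidable using (dec-true)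
open import Relation.Nullary.Negation.Core using (¬_; contradiction; contradiction-irr)
open import Relation.Unary using (Pred; Decidable)

-- Walks, extended and shortened at their last vertex.

module Walks {V : Set} (G : Graph V) where
  open Graph G

  length-snoc : ∀ {u v w} (p : Walk G u v) (e : v ~ w) →
                length G (p ◅◅ e ◅ ε) ≡ suc (length G p)
  length-snoc ε       e = refl
  length-snoc (_ ◅ p) e = cong suc (length-snoc p e)

  vertices-snoc : ∀ {u v w} (p : Walk G u v) (e : v ~ w) →
                  vertices G (p ◅◅ e ◅ ε) ≡ vertices G p ++ w ∷ []
  vertices-snoc ε       e = refl
  vertices-snoc (_ ◅ p) e = cong (_ ∷_) (vertices-snoc p e)

  first∈ : ∀ {u v} (p : Walk G u v) → u List.∈ vertices G p
  first∈ ε       = here refl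
  first∈ (_ ◅ _) = here refl

  last∈ : ∀ {u v} (p : Walk G u v) → v List.∈ vertices G p
  last∈ ε       = here refl
  last∈ (_ ◅ p) = there (last∈ p)

  unsnoc : ∀ {u v k} (p : Walk G u v) → length G p ≡ suc k →
           ∃[ w ] w ~ v × (Σ[ q ∈ Walk G u w ] length G q ≡ k)
  unsnoc             (e ◅ ε)         refl = _ , e , ε , refl
  unsnoc {k = suc _} (e ◅ p@(_ ◅ _)) eq   with unsnoc p (ℕ.suc-injective eq)
  ... | w , e′ , q , q≡ = w , e′ , e ◅ q , cong suc q≡

  nonempty : ∀ {u v} (p : Walk G u v) → u ≢ v → 1 ≤ length G p
  nonempty ε       u≢u = contradiction refl u≢u
  nonempty (_ ◅ _) _   = s≤s z≤n

-- Acyclicity of graphs with levels and unique lower neighbours.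

module Layered {V : Set} (G : Graph V) (level : V → ℕ)
  (step : ∀ {x y} → Graph._~_ G x y → level y ≡ suc (level x) ⊎ level x ≡ suc (level y))
  (lower-unique : ∀ {x y z} → Graph._~_ G y x → Graph._~_ G z x →
                  level x ≡ suc (level y) → level x ≡ suc (level z) → y ≡ z)
  where
  open Graph G
  open Walks G

  -- A path that has gone up never turns down: at the turn both path neighbours would be lower, and
  -- `lower-unique` would identify them.
  below-first : ∀ {x y z} (e : x ~ y) (p : Walk G y z) → Unique (x ∷ vertices G p) →
                level x ≡ suc (level y) ⊎ level x < level z
  below-first e p        U with step e
  below-first e p        U | inj₂ y<x = inj₁ y<x
  below-first e ε        U | inj₁ x<y = inj₂ (ℕ.≤-reflexive (sym x<y))
  below-first e (e′ ◅ p) ((_ ∷ x≢) ∷ U) | inj₁ x<y with below-first e′ p U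
  ... | inj₁ w<y = contradiction (lower-unique e (~-sym e′) x<y w<y) (All.lookup x≢ (first∈ p))
  ... | inj₂ y<z = inj₂ (ℕ.<-trans (ℕ.≤-reflexive (sym x<y)) y<z)

  -- If the last step goes down, then by `below-first` no earlier step goes up, so the whole path
  -- descends.
  below-last : ∀ {x y z} (e : x ~ y) (p : Walk G y z) → Unique (x ∷ vertices G p) →
               (∃[ w ] w List.∈ x ∷ vertices G p × w ~ z × level z ≡ suc (level w))
               ⊎ level z < level x
  below-last e ε U with step e
  ... | inj₁ x<y = inj₁ (_ , here refl , e , x<y)
  ... | inj₂ y<x = inj₂ (ℕ.≤-reflexive (sym y<x))
  below-last e (e′ ◅ p) ((_ ∷ x≢) ∷ U) with below-last e′ p U
  ... | inj₁ (w , w∈ , e″ , w<z) = inj₁ (w , there w∈ , e″ , w<z)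
  ... | inj₂ z<y with step e | below-first e′ p U
  ...   | inj₂ y<x | _ = inj₂ (ℕ.<-trans z<y (ℕ.≤-reflexive (sym y<x)))
  ...   | inj₁ x<y | inj₁ w<y =
    contradiction (lower-unique e (~-sym e′) x<y w<y) (All.lookup x≢ (first∈ p))
  ...   | inj₁ x<y | inj₂ y<z = contradiction y<z (ℕ.<-asym z<y)

  level-step : ∀ {x y} → x ~ y → level y ≤ suc (level x)
  level-step e with step e
  ... | inj₁ x<y = ℕ.≤-reflexive x<y
  ... | inj₂ y<x = ℕ.m≤n⇒m≤1+n (ℕ.≤-trans (ℕ.n≤1+n _) (ℕ.≤-reflexive (sym y<x)))

  acyclic : ¬ Cycle G
  acyclic record { path = ε ; nontrivial = () }
  acyclic record { path = _ ◅ ε ; nontrivial = s≤s () }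
  acyclic record { path = e ◅ e′ ◅ p ; distinct = U@(x≢ ∷ U′@(y≢ ∷ _)) ; closing = c }
    with step c
  -- The last vertex is a lower neighbour of the first. Starting down, the path would have its
  -- second vertex equal to its last; starting up, it would end too high.
  ... | inj₁ z<x with below-first e (e′ ◅ p) U
  ...   | inj₁ y<x = All.lookup y≢ (last∈ p) (lower-unique (~-sym e) c y<x z<x)
  ...   | inj₂ x<z = ℕ.<-asym x<z (ℕ.≤-reflexive (sym z<x))
  -- Now the first vertex is a lower neighbour of the last. It is left out of the path given to
  -- `below-last`, so a lower neighbour found there is a second one.
  acyclic record { path = _◅_ {j = y} e (e′ ◅ p) ; distinct = x≢ ∷ U′ ; closing = c }
      | inj₂ x<z with below-last e′ p U′
  ...   | inj₁ (w , w∈ , d , w<z) = All.lookup x≢ w∈ (lower-unique (~-sym c) d x<z w<z)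
  ...   | inj₂ z<y = ℕ.<⇒≱ (subst (_< level y) x<z z<y) (level-step e)

-- Distances from `v` and the closing of cycles.

module Distance {n : ℕ} (G : Graph (Fin n)) (v : Fin n) where
  open Graph G
  open Walks G

  Far : ℕ → Fin n → Set
  Far k u = ∀ (p : Walk G v u) → k ≤ length G p

  distance-root : ∀ {u} → IsDistance G v u 0 → v ≡ u
  distance-root ((ε , refl) , _) = refl

  distance-unique : ∀ {u i j} → IsDistance G v u i → IsDistance G v u j → i ≡ j
  distance-unique ((p , refl) , i≤) ((q , refl) , j≤) = ℕ.≤-antisym (i≤ q) (j≤ p)

  distance-step : ∀ {x y i j} → x ~ y → IsDistance G v x i → IsDistance G v y j → j ≤ suc i
  distance-step e ((p , refl) , _) (_ , j≤) =
    subst (_ ≤_) (length-snoc p e) (j≤ (p ◅◅ e ◅ ε))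

  -- The last but one vertex of a shortest walk to `u`: a shorter walk to it would extend to a
  -- shorter walk to `u`.
  parent : ∀ {u k} → IsDistance G v u (suc k) → ∃[ w ] w ~ u × IsDistance G v w k
  parent ((p , p≡) , far) with unsnoc p p≡
  ... | w , e , q , q≡ = w , e , (q , q≡) , λ p′ →
    s≤s⁻¹ (subst (_ ≤_) (length-snoc p′ e) (far (p′ ◅◅ e ◅ ε)))

  walk? : ∀ k u → Dec (Σ[ p ∈ Walk G v u ] length G p ≡ k)
  walk? zero u = map′ (λ { refl → ε , refl }) (λ { (ε , refl) → refl }) (v Fin.≟ u)
  walk? (suc k) u = map′
    (λ { (w , e , p , refl) → p ◅◅ e ◅ ε , length-snoc p e })
    (λ { (p , p≡) → unsnoc p p≡ })
    (any? λ w → (w ~? u) ×-dec walk? k w)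

  far-suc : ∀ {k u} → Far k u → ¬ (Σ[ p ∈ Walk G v u ] length G p ≡ k) → Far (suc k) u
  far-suc far none p = ℕ.≤∧≢⇒< (far p) λ k≡ → none (p , sym k≡)

  -- Lengths are tried in increasing order, so the first one attained is the distance; stopping at
  -- `k` also covers unreachable vertices.
  near-or-far : ∀ k u → (∃[ d ] IsDistance G v u d × d < k) ⊎ Far k u
  near-or-far zero    u = inj₂ λ _ → z≤n
  near-or-far (suc k) u with near-or-far k u
  ... | inj₁ (d , D , d<k) = inj₁ (d , D , ℕ.m≤n⇒m≤1+n d<k)
  ... | inj₂ far with walk? k u
  ...   | yes w = inj₁ (k , (w , far) , ℕ.≤-refl)
  ...   | no ¬w = inj₂ (far-suc far ¬w)

  ball? : ∀ r → Decidable (Ball G r v)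
  ball? r u with near-or-far (suc r) u
  ... | inj₁ (d , D , s≤s d≤r) = yes (d , D , d≤r)
  ... | inj₂ far = no λ { (_ , ((p , refl) , _) , d≤r) → ℕ.<⇒≱ (far p) d≤r }

  nearer-≢ : ∀ {k w us} → IsDistance G v w k → All (Far (suc k)) us → All (w ≢_) us
  nearer-≢ ((q , refl) , _) = All.map λ { far refl → ℕ.<-irrefl refl (far q) }

  -- Two more edges and one level less leave the bound of `fork` unchanged.
  prolonged : ∀ m k → suc (suc m) + 2 * k ≡ m + 2 * suc k
  prolonged = solve-∀

  -- Induction on `k`. The condition `Far k` on the whole path keeps the parents of its ends, one
  -- step closer to `v`, off the path. Ends at level zero would both be `v`, so the parents coincide
  -- at some stage.
  fork : ∀ k {x y} (p : Walk G x y) → x ≢ y → IsDistance G v x k → IsDistance G v y k →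
         Unique (vertices G p) → All (Far k) (vertices G p) →
         ∃[ c ] cycleLength G c ≤ length G p + 2 * k
  fork zero p x≢y Dx Dy _ _ =
    contradiction (trans (sym (distance-root Dx)) (distance-root Dy)) x≢y
  fork (suc k) {x} {y} p x≢y Dx Dy U far with parent Dx | parent Dy
  ... | w , w~x , Dw@(_ , far-w) | z , z~y , Dz@(_ , far-z)
    with w Fin.≟ z
  ... | yes refl = record
      { path       = w~x ◅ p
      ; distinct   = nearer-≢ Dw far ∷ U
      -- Since `x≢y`, the path `p` has an edge, and with `w` at least three vertices.
      ; nontrivial = s≤s (nonempty p x≢y)
      ; closing    = ~-sym z~y
      } , ℕ.≤-trans (ℕ.m≤m+n _ (2 * k)) (ℕ.≤-reflexive (prolonged (length G p) k))
  ... | no w≢z with fork k (w~x ◅ p ◅◅ ~-sym z~y ◅ ε) w≢z Dw Dz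
                 -- The new ends differ from the old vertices by their distance, and from each other
                 -- by `w≢z`.
                 (subst (Unique ∘ (w ∷_)) (sym (vertices-snoc p _))
                   (All.++⁺ (nearer-≢ Dw far) (w≢z ∷ []) ∷
                    Unique.++⁺ U ([] ∷ []) λ { (u∈ , here refl) →
                      All.lookup (nearer-≢ Dz far) u∈ refl }))
                 (far-w ∷ subst (All (Far k)) (sym (vertices-snoc p _))
                   (All.++⁺ (All.map (λ f p → ℕ.<⇒≤ (f p)) far) (far-z ∷ [])))
  ...   | c , c≤ = c , ℕ.≤-trans c≤ (ℕ.≤-reflexive
          (trans (cong (λ m → suc m + 2 * k) (length-snoc p _)) (prolonged (length G p) k)))

-- The ball when every cycle is longer than `2 * r + 1`.

module ShortBall {n : ℕ} (G : Graph (Fin n)) (v : Fin n) (r : ℕ)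
  (short : ∀ c → 2 * r + 1 < cycleLength G c) where
  open Graph G
  open Distance G v

  -- The edge is a path of length one, so `fork` would close a cycle of length at most `1 + 2 * k`.
  distance-≢ : ∀ {x y k} → x ~ y → k ≤ r → IsDistance G v x k → ¬ IsDistance G v y k
  distance-≢ {x} {y} {k} e k≤r Dx Dy
    with fork k (e ◅ ε) x≢y Dx Dy ((x≢y ∷ []) ∷ [] ∷ []) (proj₂ Dx ∷ proj₂ Dy ∷ [])
    where
    x≢y : x ≢ y
    x≢y refl = ~-irref e
  ... | c , c≤ = ℕ.<⇒≱ (short c) (ℕ.≤-trans c≤ (ℕ.≤-trans (s≤s (ℕ.*-monoʳ-≤ 2 k≤r))
                   (ℕ.≤-reflexive (ℕ.+-comm 1 (2 * r)))))

  adjacent-distance : ∀ {x y i j} → x ~ y → i ≤ r → IsDistance G v x i → IsDistance G v y j →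
                      j ≡ suc i ⊎ i ≡ suc j
  adjacent-distance {i = i} {j} e i≤r Dx Dy with ℕ.<-cmp i j
  ... | tri< i<j _ _ = inj₁ (ℕ.≤-antisym (distance-step e Dx Dy) i<j)
  ... | tri≈ _ refl _ = contradiction Dy (distance-≢ e i≤r Dx)
  ... | tri> _ _ j<i = inj₂ (ℕ.≤-antisym (distance-step (~-sym e) Dy Dx) j<i)

  -- Otherwise `y`, `x`, `z` form a path of length two, and `fork` closes a cycle of length at most
  -- `2 + 2 * k`, hence at most `2 * r`.
  parent-unique : ∀ {x y z k} → y ~ x → z ~ x → k < r → IsDistance G v x (suc k) →
                  IsDistance G v y k → IsDistance G v z k → y ≡ z
  parent-unique {x} {y} {z} {k} e e′ k<r Dx Dy Dz with y Fin.≟ z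
  ... | yes y≡z = y≡z
  ... | no y≢z
    with fork k (e ◅ ~-sym e′ ◅ ε) y≢z Dy Dz
           (((λ { refl → ~-irref e }) ∷ y≢z ∷ []) ∷ ((λ { refl → ~-irref e′ }) ∷ []) ∷ [] ∷ [])
           (proj₂ Dy ∷ (λ p → ℕ.<⇒≤ (proj₂ Dx p)) ∷ proj₂ Dz ∷ [])
  ... | c , c≤ = contradiction (ℕ.≤-trans c≤ (ℕ.≤-trans
                   (ℕ.≤-trans (ℕ.≤-reflexive (sym (ℕ.*-suc 2 k))) (ℕ.*-monoʳ-≤ 2 k<r))
                   (ℕ.m≤m+n (2 * r) 1))) (ℕ.<⇒≱ (short c))

  B : Pred (Fin n) 0ℓ
  B = Ball G r v

  -- Membership is irrelevant in the vertex type; deciding it again yields a distance that can be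
  -- computed with.
  ball : (u : [ u ∈ Fin n ∣ B u ]) → B (value u)
  ball (u , irr b) = recompute (ball? r u) b

  -- Parents are closer to `v`, so the walk through them stays in the ball.
  to-root : ∀ {k u} (D : IsDistance G v u k) .(b : B u) .(b₀ : B v) → k ≤ r →
            Walk (induced G B) (u , irr b) (v , irr b₀)
  to-root {zero} D b b₀ _ with distance-root D
  ... | refl = ε
  to-root {suc k} D b b₀ k<r with parent D
  ... | w , e , Dw =
    ~-sym e ◅ to-root Dw (_ , Dw , ℕ.<⇒≤ k<r) b₀ (ℕ.<⇒≤ k<r)

  root : B v
  root = 0 , ((ε , refl) , λ _ → z≤n) , z≤n

  isTree : IsTree (induced G B)
  isTree = record
    { root      = v , irr root
    ; connected = λ u w → up u ◅◅ reverse ~-sym (up w)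
    ; acyclic   = Layered.acyclic (induced G B) (λ u → proj₁ (ball u))
        (λ {x} {y} e → adjacent-distance e (proj₂ (proj₂ (ball x)))
                         (proj₁ (proj₂ (ball x))) (proj₁ (proj₂ (ball y))))
        -- The two level equations put `y` and `z` at one common level just below `x`.
        (λ {x} {y} {z} e e′ y<x z<x → value-injective (parent-unique e e′
           (subst (_≤ r) y<x (proj₂ (proj₂ (ball x))))
           (subst (IsDistance G v _) y<x (proj₁ (proj₂ (ball x))))
           (proj₁ (proj₂ (ball y)))
           (subst (IsDistance G v _) (ℕ.suc-injective (trans (sym z<x) y<x))
             (proj₁ (proj₂ (ball z))))))
    }
    where
    up : ∀ u → Walk (induced G B) u (v , irr root)
    up u@(_ , irr b) = let d , D , d≤r = ball u in to-root D b root d≤r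

  -- The values of τ off the edges of G play no role.
  module Potential (τ : Fin n → Fin n → Sign) where

    Parent : ℕ → Fin n → Set
    Parent k u = ∃[ w ] w ~ u × IsDistance G v w k

    -- The product of `τ` along the walk of successive parents. `potentialVia` takes the parent as
    -- an argument, so that different choices can be compared.
    potential    : ∀ {k u} → IsDistance G v u k → Sign
    potentialVia : ∀ {k u} → Parent k u → Sign
    potential {zero}  D = Sign.+
    potential {suc k} D = potentialVia (parent D)
    potentialVia {u = u} (w , _ , Dw) = τ w u Sign.* potential Dw

    -- Inside the ball parents are unique, so any two choices follow the same vertices.
    potential-irr    : ∀ {k u} → k ≤ r → (D D′ : IsDistance G v u k) → potential D ≡ potential D′
    potentialVia-irr : ∀ {k u} → k < r → IsDistance G v u (suc k) → (P P′ : Parent k u) →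
                       potentialVia P ≡ potentialVia P′
    potential-irr {zero}  _   D D′ = refl
    potential-irr {suc k} k<r D D′ = potentialVia-irr k<r D (parent D) (parent D′)
    potentialVia-irr {u = u} k<r D (w , e , Dw) (_ , e′ , Dw′) with parent-unique e e′ k<r D Dw Dw′
    ... | refl = cong (τ w u Sign.*_) (potential-irr (ℕ.<⇒≤ k<r) Dw Dw′)

    potential-child : ∀ {k x y} → x ~ y → k < r →
                      (Dx : IsDistance G v x k) (Dy : IsDistance G v y (suc k)) →
                      potential Dy ≡ τ x y Sign.* potential Dx
    potential-child e k<r Dx Dy = potentialVia-irr k<r Dy (parent Dy) (_ , e , Dx)

    -- One end is the parent of the other, whose potential has the extra factor `τ`; the common
    -- factor is squared and cancels.
    potential-edge : (∀ x y → τ x y ≡ τ y x) → ∀ {x y i j} → x ~ y → i ≤ r → j ≤ r →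
                     (Dx : IsDistance G v x i) (Dy : IsDistance G v y j) →
                     potential Dx Sign.* potential Dy ≡ τ x y
    potential-edge τ-sym {x} {y} e i≤r j≤r Dx Dy with adjacent-distance e i≤r Dx Dy
    ... | inj₁ refl rewrite potential-child e j≤r Dx Dy = cancel (potential Dx) (τ x y)
      where
      cancel : ∀ s t → s Sign.* (t Sign.* s) ≡ t
      cancel Sign.- Sign.- = refl
      cancel Sign.- Sign.+ = refl
      cancel Sign.+ Sign.- = refl
      cancel Sign.+ Sign.+ = refl
    ... | inj₂ refl rewrite potential-child (~-sym e) i≤r Dy Dx
      = trans (Sign.*-assoc (τ y x) (potential Dy) (potential Dy))
          (trans (cong (τ y x Sign.*_) (Sign.s*s≡+ (potential Dy)))
            (trans (Sign.*-identityʳ (τ y x)) (τ-sym y x)))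

-- Subsets from predicates, and signs of vertex pairs.

module _ {n : ℕ} {P : Pred (Fin n) 0ℓ} (P? : Decidable P) where

  comprehension : Subset n
  comprehension = tabulate (does ∘ P?)

  ∈-comprehension⁺ : ∀ {u} → P u → u ∈ comprehension
  ∈-comprehension⁺ {u} Pu =
    lookup⇒[]= u _ (trans (lookup∘tabulate _ u) (dec-true (P? u) Pu))

  ∈-comprehension⁻ : ∀ {u} → u ∈ comprehension → P u
  ∈-comprehension⁻ {u} u∈ with P? u | trans (sym (lookup∘tabulate (does ∘ P?) u)) ([]=⇒lookup u∈)
  ... | yes Pu | _ = Pu
  ... | no _   | ()

module _ {n : ℕ} (G : Graph (Fin n)) (σ : Signing G) where
  open Graph G

  increasingSign : Fin n → Fin n → Sign
  increasingSign x y with (x Fin.<? y) ×-dec (x ~? y)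
  ... | yes e = σ ((x , y) , irr e)
  ... | no _  = Sign.+

  -- At most one of the two factors comes from an edge; the other is +.
  edgeSign : Fin n → Fin n → Sign
  edgeSign x y = increasingSign x y Sign.* increasingSign y x

  edgeSign-sym : ∀ x y → edgeSign x y ≡ edgeSign y x
  edgeSign-sym x y = Sign.*-comm (increasingSign x y) (increasingSign y x)

  edgeSign-edge : ∀ e → edgeSign (proj₁ (value e)) (proj₂ (value e)) ≡ σ e
  edgeSign-edge ((x , y) , irr e)
    with (x Fin.<? y) ×-dec (x ~? y) | (y Fin.<? x) ×-dec (y ~? x)
  ... | no ¬e | _ = contradiction-irr e ¬e
  ... | yes (x<y , _) | yes (y<x , _) = contradiction x<y (ℕ.<-asym y<x)
  ... | yes _ | no _ = Sign.*-identityʳ _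

-- Used with membership of the two endpoints in the switching set as `A` and `B`, where the right
-- side becomes `δ`.
product-negative⇔ : ∀ {A B : Set} (s t : Sign) → s ≡ Sign.- ⇔ A → t ≡ Sign.- ⇔ B →
                    s Sign.* t ≡ Sign.- ⇔ ((A × ¬ B) ⊎ (¬ A × B))
product-negative⇔ {A} {B} s t a b = mk⇔ (to-δ s t a b) (from-δ s t a b)
  where
  open Equivalence
  to-δ : ∀ s t → s ≡ Sign.- ⇔ A → t ≡ Sign.- ⇔ B → s Sign.* t ≡ Sign.- → (A × ¬ B) ⊎ (¬ A × B)
  to-δ Sign.- Sign.+ a b _ = inj₁ (to a refl , λ y → contradiction (from b y) λ ())
  to-δ Sign.+ Sign.- a b _ = inj₂ ((λ x → contradiction (from a x) λ ()) , to b refl)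
  from-δ : ∀ s t → s ≡ Sign.- ⇔ A → t ≡ Sign.- ⇔ B → (A × ¬ B) ⊎ (¬ A × B) → s Sign.* t ≡ Sign.-
  from-δ Sign.- Sign.+ a b _                = refl
  from-δ Sign.+ Sign.- a b _                = refl
  from-δ Sign.- Sign.- a b (inj₁ (_ , ¬y)) = contradiction (to b refl) ¬y
  from-δ Sign.- Sign.- a b (inj₂ (¬x , _)) = contradiction (to a refl) ¬x
  from-δ Sign.+ Sign.+ a b (inj₁ (x , _))  = from a x
  from-δ Sign.+ Sign.+ a b (inj₂ (_ , y))  = from b y

-- From girth to cycle lengths, and the theorem.

girth-bound : ∀ {V : Set} (G : Graph V) {g m} → IsGirth G g → [ m ] <⁺ g →
              ∀ c → m < cycleLength G c
girth-bound G (_ , shortest) [ m<g ]    c = ℕ.<-≤-trans m<g (shortest c)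
girth-bound G none           [ _ ]<⊤⁺ c = contradiction c none

proposition2 : ∀ {n : ℕ} (G : Graph (Fin n)) (g : ℕ ⁺) → IsGirth G g →
    ∀ (v : Fin n) (r : ℕ) → [ 2 * r + 1 ] <⁺ g →
    IsTree (induced G (Ball G r v))
    × (∀ (σ : Signing G) →
    Σ[ S ∈ Subset n ]
    (∀ u → u ∈ S → Ball G r v u)
    × (∀ (e : Edge G) → InducedEdge G (Ball G r v) e →
    (σ e ≡ Sign.-) ⇔ δ G S e))
proposition2 {n} G g girth v r r<g = isTree , λ σ →
  let open Switching σ in comprehension negative?
                            , (λ u → negative⇒ball ∘ ∈-comprehension⁻ negative?)
                            , cut
  where
  open Graph G
  open Distance G v
  open ShortBall G v r (girth-bound G girth r<g)
  module Switching (σ : Signing G) where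
    open Potential (edgeSign G σ)

    sign : Fin n → Sign
    sign u with ball? r u
    ... | yes (_ , D , _) = potential D
    -- The positive default keeps the switching set inside the ball.
    ... | no _            = Sign.+

    negative? : Decidable (λ u → sign u ≡ Sign.-)
    negative? u = sign u Sign.≟ Sign.-

    negative⇒ball : ∀ {u} → sign u ≡ Sign.- → Ball G r v u
    -- Outside the ball the hypothesis would read `Sign.+ ≡ Sign.-`.
    negative⇒ball {u} _ with yes b ← ball? r u = b

    sign-edge : ∀ {x y} → x ~ y → B x → B y → sign x Sign.* sign y ≡ edgeSign G σ x y
    sign-edge {x} {y} e bx by with ball? r x | ball? r y
    ... | yes (_ , Dx , i≤r) | yes (_ , Dy , j≤r) =
      potential-edge (edgeSign-sym G σ) e i≤r j≤r Dx Dy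
    ... | no ¬bx | _      = contradiction bx ¬bx
    ... | _      | no ¬by = contradiction by ¬by

    cut : ∀ e → InducedEdge G B e → σ e ≡ Sign.- ⇔ δ G (comprehension negative?) e
    cut e@((x , y) , irr x~y) (bx , by) =
      subst (λ s → s ≡ Sign.- ⇔ δ G (comprehension negative?) e)
        -- Adjacency is irrelevant in `e` and is recovered from its decision.
        (trans (sign-edge (recompute (x ~? y) (proj₂ x~y)) bx by) (edgeSign-edge G σ e))
        (product-negative⇔ (sign x) (sign y) sign⇔ sign⇔)
      where
      sign⇔ : ∀ {u} → sign u ≡ Sign.- ⇔ u ∈ comprehension negative?
      sign⇔ = mk⇔ (∈-comprehension⁺ negative?) (∈-comprehension⁻ negative?)
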